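{- Let $G$ be a connected, undirected, unweighted planar graph (with a fixed planar embedding) with a designated face $f$. Let $k \ge 1$ be the number of edges of the facial walk of $f$, and let $S=(s_0,\dots,s_{k-1})$ be the sequence of vertices of $f$ listed in cyclic order along this walk. Let $p_\#$ denote the number of distinct patterns $p^v$ (with respect to $S$) over all vertices $v$ of $G$. Then $p_\# \in O(k^2)$, where the constant hidden in the $O$-notation is absolute (independent of $G$, $f$ and $k$).
   Context: For vertices $x,y$ of $G$, $d_G(x,y)$ denotes the shortest-path distance (number of edges) between $x$ and $y$ in $G$. The facial walk of $f$ is the closed walk bounding $f$; it need not be a simple cycle, so the vertices $s_0,\dots,s_{k-1}$ need not be distinct. The pattern of a vertex $v$ of $G$ is the vector $$p^v=\langle d_G(v,s_1)-d_G(v,s_0),\ d_G(v,s_2)-d_G(v,s_1),\ \ldots,\ d_G(v,s_{k-1})-d_G(v,s_{k-2})\rangle .$$ -}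

module Defs where

open import Data.Bool using (Bool; true; false; not)
import Data.Bool.Properties as Bool
open import Data.Fin using (Fin; toℕ)
import Data.Fin.Properties as Fin
open import Data.Integer using (ℤ; +_; _-_)
import Data.Integer.Properties as ℤ
open import Data.List using (length; map; deduplicate; allFin)
open import Data.Nat using (ℕ; zero; suc; pred; _+_; _≤_; _<_; z≤n; s≤s)
open import Data.Nat.GeneralisedArithmetic using (iterate)
open import Data.Product using (_×_; _,_; proj₁; proj₂; ∃; ∃-syntax)
open import Data.Vec using (Vec; tabulate)
import Data.Vec.Properties as Vec
open import Function using (_⇔_; _↔_; Inverse)
open import Relation.Binary.PropositionalEquality using (_≡_; _≢_; refl)
open import Relation.Nullary using (Dec; yes; no; contradiction)
open import Relation.Nullary.Decidable using (map′; _×-dec_)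
open import Relation.Unary using (Decidable)

-- Finite undirected graphs; loops and parallel edges are allowed.
record Graph : Set where
  field
    #V #E : ℕ
    ends  : Fin #E → Fin #V × Fin #V

  Vertex : Set
  Vertex = Fin #V

  -- A dart is an edge together with a direction of travel; the order of the
  -- two components of `ends` serves only to tell the two darts of an edge apart.
  Dart : Set
  Dart = Fin #E × Bool

  rev : Dart → Dart
  rev (e , b) = e , not b

  tail head : Dart → Vertex
  tail (e , false) = proj₁ (ends e)
  tail (e , true)  = proj₂ (ends e)
  head d = tail (rev d)

  Adjacent : Vertex → Vertex → Set
  Adjacent u v = ∃[ d ] (tail d ≡ u × head d ≡ v)

  -- Walk u v ℓ: walks from u to v with ℓ edges.
  data Walk : Vertex → Vertex → ℕ → Set where
    []  : ∀ {u} → Walk u u 0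
    _∷_ : ∀ {u v w ℓ} → Adjacent u v → Walk v w ℓ → Walk u w (suc ℓ)

  Connected : Set
  Connected = ∀ u v → ∃[ ℓ ] Walk u v ℓ

least : ∀ {P : ℕ → Set} → Decidable P → ∀ n → P n →
        ∃[ m ] (P m × (∀ {j} → P j → m ≤ j))
least P? zero    p = zero , p , λ _ → z≤n
least {P} P? (suc n) p with P? zero
... | yes p₀ = zero , p₀ , λ _ → z≤n
... | no ¬p₀ with least {λ i → P (suc i)} (λ i → P? (suc i)) n p
...   | m , pₘ , min =
        suc m , pₘ , λ { {zero} q → contradiction q ¬p₀ ; {suc j} q → s≤s (min q) }

module _ (G : Graph) where
  open Graph G

  adjacent? : ∀ u v → Dec (Adjacent u v)
  adjacent? u v = map′ to from
    (Fin.any? λ e → any-Bool? λ b → (tail (e , b) Fin.≟ u) ×-dec (head (e , b) Fin.≟ v))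
    where
    any-Bool? : ∀ {P : Bool → Set} → Decidable P → Dec (∃ P)
    any-Bool? P? with P? false | P? true
    ... | yes p | _     = yes (false , p)
    ... | no _  | yes p = yes (true , p)
    ... | no ¬p | no ¬q = no λ { (false , p) → ¬p p ; (true , q) → ¬q q }
    to : (∃[ e ] ∃[ b ] (tail (e , b) ≡ u × head (e , b) ≡ v)) → Adjacent u v
    to (e , b , p) = (e , b) , p
    from : Adjacent u v → ∃[ e ] ∃[ b ] (tail (e , b) ≡ u × head (e , b) ≡ v)
    from ((e , b) , p) = e , b , p

  walk? : ∀ u v ℓ → Dec (Walk u v ℓ)
  walk? u v zero = map′ (λ { refl → [] }) (λ { [] → refl }) (u Fin.≟ v)
  walk? u v (suc ℓ) =
    map′ (λ { (_ , a , w) → a ∷ w }) (λ { (a ∷ w) → _ , a , w })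
      (Fin.any? λ x → adjacent? u x ×-dec walk? x v ℓ)

  module _ (conn : Connected) where

    shortest : ∀ u v → ∃[ m ] (Walk u v m × (∀ {j} → Walk u v j → m ≤ j))
    shortest u v = least (walk? u v) (proj₁ (conn u v)) (proj₂ (conn u v))

    dist : Vertex → Vertex → ℕ
    dist u v = proj₁ (shortest u v)

-- Combinatorial embedding of a connected graph with at least one edge in the
-- sphere: a rotation system whose faces satisfy Euler's formula.  (The edgeless
-- graph has no facial walk of positive length.)
record PlanarEmbedding (G : Graph) : Set where
  open Graph G
  field
    -- The next dart in cyclic order around the common tail.
    rotation   : Dart ↔ Dart
  rot : Dart → Dart
  rot = Inverse.to rotation
  field
    rot-orbits : ∀ d d′ → tail d ≡ tail d′ ⇔ (∃[ i ] iterate rot d i ≡ d′)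

  -- The successor of a dart on the boundary of the face it lies on.
  next : Dart → Dart
  next d = rot (rev d)

  field
    #F           : ℕ
    face         : Dart → Fin #F
    face-surj    : ∀ f → ∃[ d ] face d ≡ f
    face-orbits  : ∀ d d′ → face d ≡ face d′ ⇔ (∃[ i ] iterate next d i ≡ d′)
    euler        : #V + #F ≡ #E + 2

-- A facial walk of f with k edges: one full turn around the face f.  Only the
-- first dart is a choice.
record FacialWalk {G : Graph} (E : PlanarEmbedding G)
                  (f : Fin (PlanarEmbedding.#F E)) (k : ℕ) : Set where
  open Graph G
  open PlanarEmbedding E
  field
    start   : Dart
    on-face : face start ≡ f
    closes  : iterate next start k ≡ start
    minimal : ∀ j → 0 < j → j < k → iterate next start j ≢ start

  -- S = (s 0 , … , s (k - 1)).
  s : ℕ → Vertex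
  s i = tail (iterate next start i)

module _ {G : Graph} (conn : Graph.Connected G) {E : PlanarEmbedding G}
         {f : Fin (PlanarEmbedding.#F E)} {k : ℕ} (S : FacialWalk E f k) where
  open Graph G
  open FacialWalk S

  pattern-of : Vertex → Vec ℤ (pred k)
  pattern-of v = tabulate λ i →
    + dist G conn v (s (suc (toℕ i))) - + dist G conn v (s (toℕ i))

  #patterns : ℕ
  #patterns = length (deduplicate (Vec.≡-dec ℤ._≟_) (map pattern-of (allFin #V)))

{-# OPTIONS --safe #-}

-- If v, u are vertices and a < b < c < e positions on the face, a shortest path system from
-- v to s a, s c must meet one from u to s b, s e.  Exchanging tails at a common vertex shows
-- that i ↦ d(v, s i) − d(u, s i) is never smaller at both of a, c than at both of b, e.
--
-- Hence, among the classes of vertices agreeing on the positions 0 … j, two distinct classes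
-- that both split at position j + 1, at the same threshold for the next step, differ in
-- d(·, s j) − d(·, s 0): otherwise vertices chosen from them alternate at 0 < i < j < j + 1
-- for some i.  That difference takes at most 2k + 1 values, so each position adds O(k)
-- classes and k positions give O(k²).
--
-- Planarity enters through Euler's formula: it makes every cycle modulo 2 the boundary of a
-- set of faces, by a dimension count with a BFS tree, which is the Jordan curve theorem
-- needed for the two path systems.
module Submission where

open import Defs
open import Algebra.Bundles using (CommutativeRing)
open import Data.Bool using (Bool; true; false; not; _∧_; _xor_)
import Data.Bool.Properties as Bool
open import Data.Fin using (Fin; zero; suc; toℕ; fromℕ<; splitAt; join; punchOut;
  combine; finToFun; funToFin)
import Data.Fin.Properties as Fin
open import Data.Integer using (+_; _-_; _⊖_)
import Data.Integer.Properties as ℤ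
open import Data.List using (List; length; lookup; map; deduplicate; allFin)
open import Data.List.Membership.Propositional.Properties using (∈-lookup; ∈-map⁻; ∈-deduplicate⁻)
import Data.List.Relation.Unary.All as All
open import Data.List.Relation.Unary.AllPairs using (_∷_)
open import Data.List.Relation.Unary.Unique.DecPropositional.Properties using (deduplicate-!)
open import Data.List.Relation.Unary.Unique.Propositional using (Unique)
open import Data.Nat using (ℕ; zero; suc; pred; >-nonZero; _+_; _*_; _∸_; _^_; _≤_; _<_; z≤n; s≤s)
open import Data.Nat.GeneralisedArithmetic using (iterate)
import Data.Nat.Properties as ℕ
open import Data.Nat.Tactic.RingSolver using (solve-∀)
open import Data.Product using (_×_; _,_; proj₁; proj₂; ∃-syntax)
open import Data.Product.Function.NonDependent.Propositional using (_×-↔_)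
import Data.Product.Properties as Product
open import Data.Sum using (_⊎_; inj₁; inj₂; [_,_]′)
open import Data.Sum.Properties using (inj₁-injective; inj₂-injective)
open import Data.Unit using (⊤; tt)
import Data.Vec.Properties as Vec
open import Function using (_∘_; _↔_; Inverse; Equivalence; mk⇔; Injective)
open import Function.Construct.Composition using (_↔-∘_)
open import Function.Construct.Identity using (↔-id)
open import Function.Construct.Symmetry using (↔-sym)
open import Relation.Binary.Definitions using (DecidableEquality; tri<; tri≈; tri>)
open import Relation.Binary.PropositionalEquality
  using (_≡_; _≢_; _≗_; refl; sym; trans; cong; cong₂; subst; module ≡-Reasoning)
open import Relation.Nullary using (¬_; Dec; yes; no; does; contradiction)
open import Relation.Nullary.Decidable using (dec-true; dec-false; does-⇔; _×-dec_)
open import Relation.Unary using (Decidable)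

open import Algebra.Properties.Semiring.Sum
  (CommutativeRing.semiring Bool.xor-∧-commutativeRing)
  using (sum; sum-cong-≗; sum-replicate-zero; ∑-distrib-+; ∑-comm; sum-permute; *-distribˡ-sum)

-- Arithmetic modulo 2 and finite sums

xor-false⇒≡ : ∀ a b → a xor b ≡ false → a ≡ b
xor-false⇒≡ false false _ = refl
xor-false⇒≡ true  true  _ = refl

xor-interchange : ∀ a b c d → (a xor b) xor (c xor d) ≡ (a xor c) xor (b xor d)
xor-interchange false false c d = refl
xor-interchange false true  false d = refl
xor-interchange false true  true  d = refl
xor-interchange true  false c d = Bool.not-distribˡ-xor c d
xor-interchange true  true  false false = refl
xor-interchange true  true  false true = refl
xor-interchange true  true  true  false = refl
xor-interchange true  true  true  true = refl

xor-cancel : ∀ a b c → (a xor b) xor (b xor c) ≡ a xor c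
xor-cancel false false c = refl
xor-cancel false true  c = Bool.not-involutive c
xor-cancel true  false c = refl
xor-cancel true  true  c = refl

xor-cancelˡ : ∀ a {b c} → a xor b ≡ a xor c → b ≡ c
xor-cancelˡ false eq = eq
xor-cancelˡ true  eq = Bool.not-injective eq

sum-false : ∀ {n} {g : Fin n → Bool} → (∀ i → g i ≡ false) → sum g ≡ false
sum-false {n} g≗0 = trans (sum-cong-≗ g≗0) (sum-replicate-zero n)

sum-single : ∀ {n} {g : Fin n → Bool} j → (∀ i → i ≢ j → g i ≡ false) → sum g ≡ g j
sum-single {g = g} zero    g≗0 = trans
  (cong (g zero xor_) (sum-false λ i → g≗0 (suc i) λ ())) (Bool.xor-identityʳ _)
sum-single {g = g} (suc j) g≗0 = trans
  (cong (_xor sum (g ∘ suc)) (g≗0 zero λ ()))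
  (sum-single j λ i i≢j → g≗0 (suc i) (i≢j ∘ Fin.suc-injective))

module FiniteSum {A : Set} {n} (enum : Fin n ↔ A) where
  open Inverse enum using (to; from; strictlyInverseˡ; strictlyInverseʳ)

  -- Sums over darts stay opaque, so that later reasoning goes through these laws and never unfolds
  -- the enumeration.
  abstract
    ⨁ : (A → Bool) → Bool
    ⨁ g = sum (g ∘ to)

    ⨁-cong : ∀ {g h} → g ≗ h → ⨁ g ≡ ⨁ h
    ⨁-cong g≗h = sum-cong-≗ (g≗h ∘ to)

    ⨁-xor : ∀ g h → ⨁ (λ a → g a xor h a) ≡ ⨁ g xor ⨁ h
    ⨁-xor g h = ∑-distrib-+ (g ∘ to) (h ∘ to)

    ⨁-single : ∀ {g} b → (∀ a → a ≢ b → g a ≡ false) → ⨁ g ≡ g b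
    ⨁-single {g} b g≗0 = trans
      (sum-single (from b) λ i i≢ → g≗0 (to i) λ eq →
        i≢ (trans (sym (strictlyInverseʳ i)) (cong from eq)))
      (cong g (strictlyInverseˡ b))

    ⨁-pick : ∀ (_≟_ : DecidableEquality A) (g : A → Bool) b → ⨁ (λ a → does (b ≟ a) ∧ g a) ≡ g b
    ⨁-pick _≟_ g b = trans
      (⨁-single {λ a → does (b ≟ a) ∧ g a} b λ a a≢b →
        cong (λ χ → χ ∧ g a) (dec-false (b ≟ a) (a≢b ∘ sym)))
      (cong (λ χ → χ ∧ g b) (dec-true (b ≟ b) refl))

    ⨁-permute : ∀ (π : A ↔ A) g → ⨁ (g ∘ Inverse.to π) ≡ ⨁ g
    ⨁-permute π g = sym (trans (sum-permute (g ∘ to) (↔-sym enum ↔-∘ (π ↔-∘ enum)))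
      (sum-cong-≗ {n} λ i → cong g (strictlyInverseˡ (Inverse.to π (to i)))))

    ⨁-∧ : ∀ b g → b ∧ ⨁ g ≡ ⨁ (λ a → b ∧ g a)
    ⨁-∧ b g = *-distribˡ-sum b (g ∘ to)

    ⨁-sum-comm : ∀ {m} (g : A → Fin m → Bool) → ⨁ (λ a → sum (g a)) ≡ sum (λ i → ⨁ λ a → g a i)
    ⨁-sum-comm g = ∑-comm (λ j i → g (to j) i)

-- Pigeonhole and linear algebra over 𝔽₂

Fin-injective⇒surjective : ∀ {n} (f : Fin n → Fin n) → Injective _≡_ _≡_ f → ∀ y → ∃[ x ] f x ≡ y
Fin-injective⇒surjective {suc n} f inj y with Fin.any? (λ x → f x Fin.≟ y)
... | yes x∈ = x∈
-- If `y` is missed, punching it out of the codomain gives an injection of `Fin (suc n)` into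
-- `Fin n`.
... | no  x∉ = contradiction (Fin.injective⇒≤ out-injective) ℕ.1+n≰n
  where
  y≢ : ∀ x → y ≢ f x
  y≢ x eq = x∉ (x , sym eq)
  out-injective : Injective _≡_ _≡_ (λ x → punchOut (y≢ x))
  out-injective {x} {x′} eq = inj (Fin.punchOut-injective (y≢ x) (y≢ x′) eq)

-- Over 𝔽₂ rank–nullity in square dimension is the pigeonhole principle on the 2ⁿ vectors.
module _ {A B : Set} {n} (enumA : Fin n ↔ A) (enumB : Fin n ↔ B) where
  private
    module A = Inverse enumA
    module B = Inverse enumB
    module 𝟚 = Inverse Fin.2↔Bool

    decode : ∀ {C : Set} → (C → Fin n) → Fin (2 ^ n) → C → Bool
    decode pos i c = 𝟚.to (finToFun i (pos c))

    encode : (Fin n → Bool) → Fin (2 ^ n)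
    encode g = funToFin (𝟚.from ∘ g)

    decode-encode : ∀ {C : Set} (enum : Fin n ↔ C) g →
                    decode (Inverse.from enum) (encode (g ∘ Inverse.to enum)) ≗ g
    decode-encode enum g c = begin
      𝟚.to (finToFun (encode (g ∘ Inverse.to enum)) (Inverse.from enum c))
        ≡⟨ cong 𝟚.to (Fin.finToFun-funToFin (𝟚.from ∘ g ∘ Inverse.to enum) _) ⟩
      𝟚.to (𝟚.from (g (Inverse.to enum (Inverse.from enum c))))
        ≡⟨ 𝟚.strictlyInverseˡ _ ⟩
      g (Inverse.to enum (Inverse.from enum c))
        ≡⟨ cong g (Inverse.strictlyInverseˡ enum c) ⟩
      g c ∎
      where open ≡-Reasoning

    funToFin-cong : ∀ {m k} {g h : Fin m → Fin k} → g ≗ h → funToFin g ≡ funToFin h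
    funToFin-cong {zero}  g≗h = refl
    funToFin-cong {suc m} g≗h = cong₂ combine (g≗h zero) (funToFin-cong (g≗h ∘ suc))

    decode-injective : ∀ {i j} → decode A.from i ≗ decode A.from j → i ≡ j
    decode-injective {i} {j} eq = begin
      i                       ≡⟨ Fin.funToFin-finToFin {n} {2} i ⟨
      funToFin {n} (finToFun i)   ≡⟨ funToFin-cong same ⟩
      funToFin {n} (finToFun j)   ≡⟨ Fin.funToFin-finToFin {n} {2} j ⟩
      j ∎
      where
      open ≡-Reasoning
      same : finToFun i ≗ finToFun j
      same a = begin
        finToFun i a                     ≡⟨ cong (finToFun i) (A.strictlyInverseʳ a) ⟨
        finToFun i (A.from (A.to a))     ≡⟨ 𝟚.strictlyInverseʳ _ ⟨
        𝟚.from (decode A.from i (A.to a)) ≡⟨ cong 𝟚.from (eq (A.to a)) ⟩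
        𝟚.from (decode A.from j (A.to a)) ≡⟨ 𝟚.strictlyInverseʳ _ ⟩
        finToFun j (A.from (A.to a))     ≡⟨ cong (finToFun j) (A.strictlyInverseʳ a) ⟩
        finToFun j a ∎

  -- Conjugating by the codes turns `Φ` into a self-map of `Fin (2 ^ n)`. By additivity, two vectors
  -- with equal image differ by a kernel vector, so this map is injective and therefore hits the
  -- code of `z`.
  trivial-kernel⇒surjective : (Φ : (A → Bool) → B → Bool) →
    (∀ x y b → Φ (λ a → x a xor y a) b ≡ Φ x b xor Φ y b) →
    (∀ x → (∀ b → Φ x b ≡ false) → ∀ a → x a ≡ false) →
    ∀ z → ∃[ x ] Φ x ≗ z
  trivial-kernel⇒surjective Φ additive kernel z = decode A.from i , λ b → begin
      Φ (decode A.from i) b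
        ≡⟨ decode-encode enumB _ b ⟨
      decode B.from (encode (Φ (decode A.from i) ∘ B.to)) b
        ≡⟨ cong (λ c → decode B.from c b) fi≡ ⟩
      decode B.from (encode (z ∘ B.to)) b
        ≡⟨ decode-encode enumB z b ⟩
      z b ∎
    where
    open ≡-Reasoning
    inj : Injective _≡_ _≡_ (λ i → encode (Φ (decode A.from i) ∘ B.to))
    inj {i} {j} eq = decode-injective λ a → xor-false⇒≡ _ _ (kernel _ (λ b → begin
      Φ (λ a → decode A.from i a xor decode A.from j a) b
        ≡⟨ additive _ _ b ⟩
      Φ (decode A.from i) b xor Φ (decode A.from j) b
        ≡⟨ cong (_xor Φ (decode A.from j) b) (same b) ⟩
      Φ (decode A.from j) b xor Φ (decode A.from j) b
        ≡⟨ Bool.xor-same (Φ (decode A.from j) b) ⟩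
      false ∎) a)
      where
      same : ∀ b → Φ (decode A.from i) b ≡ Φ (decode A.from j) b
      same b = begin
        Φ (decode A.from i) b ≡⟨ decode-encode enumB _ b ⟨
        decode B.from (encode (Φ (decode A.from i) ∘ B.to)) b
          ≡⟨ cong (λ c → decode B.from c b) eq ⟩
        decode B.from (encode (Φ (decode A.from j) ∘ B.to)) b
          ≡⟨ decode-encode enumB _ b ⟩
        Φ (decode A.from j) b ∎

    preimage = Fin-injective⇒surjective _ inj (encode (z ∘ B.to))
    i = proj₁ preimage
    fi≡ = proj₂ preimage

-- Iteration, bounds and counting distinct values

iterate-+ : ∀ {A : Set} (h : A → A) x m n → iterate h x (m + n) ≡ iterate h (iterate h x m) n
iterate-+ h x zero    n = refl
iterate-+ h x (suc m) n = iterate-+ h (h x) m n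

iterate-suc : ∀ {A : Set} (h : A → A) x n → iterate h x (suc n) ≡ h (iterate h x n)
iterate-suc h x zero    = refl
iterate-suc h x (suc n) = iterate-suc h (h x) n

∃-upper-bound : ∀ {n} (g : Fin n → ℕ) → ∃[ b ] (∀ i → g i ≤ b)
∃-upper-bound {zero}  g = 0 , λ ()
∃-upper-bound {suc n} g with b , g≤b ← ∃-upper-bound (g ∘ suc) =
  g zero + b , λ { zero → ℕ.m≤m+n _ b ; (suc i) → ℕ.≤-trans (g≤b i) (ℕ.m≤n+m b _) }

lookup-injective : ∀ {A : Set} {xs : List A} → Unique xs → ∀ {i j} →
                   lookup xs i ≡ lookup xs j → i ≡ j
lookup-injective (x∉ ∷ xs!) {zero}  {zero}  eq = refl
lookup-injective (x∉ ∷ xs!) {zero}  {suc j} eq = contradiction eq (All.lookup x∉ (∈-lookup j))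
lookup-injective (x∉ ∷ xs!) {suc i} {zero}  eq = contradiction (sym eq) (All.lookup x∉ (∈-lookup i))
lookup-injective (x∉ ∷ xs!) {suc i} {suc j} eq = cong suc (lookup-injective xs! eq)

-- Choose for each entry of the deduplicated list an argument that `g` sends to it. Equal colours of
-- the chosen arguments force equal entries, hence equal indices, so colouring them injects the
-- indices into `Fin n`.
length-deduplicate-≤ : ∀ {A : Set} (_≟_ : DecidableEquality A) {m n} (g : Fin m → A)
  (c : Fin m → Fin n) → (∀ {u v} → c u ≡ c v → g u ≡ g v) →
  length (deduplicate _≟_ (map g (allFin m))) ≤ n
length-deduplicate-≤ _≟_ g c c⇒g = Fin.injective⇒≤ {f = c ∘ preimage} λ {i} {j} eq →
  lookup-injective (deduplicate-! _≟_ values)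
    (trans (g-preimage i) (trans (c⇒g eq) (sym (g-preimage j))))
  where
  values = map g (allFin _)
  origin : ∀ i → ∃[ u ] _ × lookup (deduplicate _≟_ values) i ≡ g u
  origin i = ∈-map⁻ g (∈-deduplicate⁻ _≟_ values (∈-lookup i))
  preimage = λ i → proj₁ (origin i)
  g-preimage = λ i → proj₂ (proj₂ (origin i))

join-injective : ∀ {m n} {x y : Fin m ⊎ Fin n} → join m n x ≡ join m n y → x ≡ y
join-injective {m} {n} {x} {y} eq =
  trans (sym (Fin.splitAt-join m n x)) (trans (cong (splitAt m) eq) (Fin.splitAt-join m n y))

+-minus-cong : ∀ m n m′ n′ → m + n′ ≡ m′ + n → + m - + n ≡ + m′ - + n′
+-minus-cong m n m′ n′ eq = begin
  + m - + n                ≡⟨ ℤ.m-n≡m⊖n m n ⟩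
  m ⊖ n                    ≡⟨ ℤ.+-cancelˡ-⊖ n′ m n ⟨
  (n′ + m) ⊖ (n′ + n)
    ≡⟨ cong₂ _⊖_ (trans (ℕ.+-comm n′ m) (trans eq (ℕ.+-comm m′ n))) (ℕ.+-comm n′ n) ⟩
  (n + m′) ⊖ (n + n′)      ≡⟨ ℤ.+-cancelˡ-⊖ n m′ n′ ⟩
  m′ ⊖ n′                  ≡⟨ ℤ.m-n≡m⊖n m′ n′ ⟨
  + m′ - + n′              ∎
  where open ≡-Reasoning

-- Walks and chains modulo 2

module GraphTheory (G : Graph) where
  open Graph G

  _≟ᵈ_ : DecidableEquality Dart
  _≟ᵈ_ = Product.≡-dec Fin._≟_ Bool._≟_

  rev-involutive : ∀ d → rev (rev d) ≡ d
  rev-involutive (e , b) = cong (e ,_) (Bool.not-involutive b)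

  Adjacent-sym : ∀ {u v} → Adjacent u v → Adjacent v u
  Adjacent-sym (d , refl , refl) = rev d , refl , cong tail (rev-involutive d)

  -- Lengths are forgotten: the Jordan argument only asks which vertices a walk visits, end points
  -- included.
  data WalkIn (P : Vertex → Set) : Vertex → Vertex → Set where
    [_]     : ∀ {u} → P u → WalkIn P u u
    _∷⟨_⟩_ : ∀ {u v w} → P u → Adjacent u v → WalkIn P v w → WalkIn P u w

  walkIn-trans : ∀ {P u v w} → WalkIn P u v → WalkIn P v w → WalkIn P u w
  walkIn-trans [ _ ]          ρ = ρ
  walkIn-trans (p ∷⟨ a ⟩ π) ρ = p ∷⟨ a ⟩ walkIn-trans π ρ

  walkIn-first : ∀ {P u v} → WalkIn P u v → P u
  walkIn-first [ p ]          = p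
  walkIn-first (p ∷⟨ _ ⟩ _) = p

  walkIn-sym : ∀ {P u v} → WalkIn P u v → WalkIn P v u
  walkIn-sym [ p ]          = [ p ]
  walkIn-sym (p ∷⟨ a ⟩ π) =
    walkIn-trans (walkIn-sym π) (walkIn-first π ∷⟨ Adjacent-sym a ⟩ [ p ])

  walkIn-map : ∀ {P Q u v} → (∀ {w} → P w → Q w) → WalkIn P u v → WalkIn Q u v
  walkIn-map P⊆Q [ p ]          = [ P⊆Q p ]
  walkIn-map P⊆Q (p ∷⟨ a ⟩ π) = P⊆Q p ∷⟨ a ⟩ walkIn-map P⊆Q π

  Walk⇒WalkIn : ∀ {u v ℓ} → Walk u v ℓ → WalkIn (λ _ → ⊤) u v
  Walk⇒WalkIn []      = [ tt ]
  Walk⇒WalkIn (a ∷ w) = tt ∷⟨ a ⟩ Walk⇒WalkIn w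

  walk-trans : ∀ {u v w m n} → Walk u v m → Walk v w n → Walk u w (m + n)
  walk-trans []      ρ = ρ
  walk-trans (a ∷ π) ρ = a ∷ walk-trans π ρ

  Chain : Set
  Chain = Fin #E → Bool

  darts : Fin (#E * 2) ↔ Dart
  darts = (↔-id _ ×-↔ Fin.2↔Bool) ↔-∘ Fin.*↔×

  open FiniteSum darts

  δ : Dart → Chain
  δ d e = does (proj₁ d Fin.≟ e)

  ⟨_⟩ : Vertex → Vertex → Bool
  ⟨ u ⟩ v = does (u Fin.≟ v)

  -- Summing over darts counts each edge once at either end, so a loop contributes twice and
  -- cancels.
  ∂ : Chain → Vertex → Bool
  ∂ z v = ⨁ λ d → ⟨ tail d ⟩ v ∧ z (proj₁ d)

  ∂-cong : ∀ {z z′} → z ≗ z′ → ∂ z ≗ ∂ z′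
  ∂-cong z≗z′ v = ⨁-cong λ d → cong (⟨ tail d ⟩ v ∧_) (z≗z′ (proj₁ d))

  ∂-xor : ∀ z z′ v → ∂ (λ e → z e xor z′ e) v ≡ ∂ z v xor ∂ z′ v
  ∂-xor z z′ v = trans
    (⨁-cong λ d → Bool.∧-distribˡ-xor (⟨ tail d ⟩ v) (z (proj₁ d)) (z′ (proj₁ d)))
    (⨁-xor _ _)

  ∂-false : ∀ v → ∂ (λ _ → false) v ≡ false
  ∂-false v = trans (∂-xor (λ _ → false) (λ _ → false) v) (Bool.xor-same (∂ (λ _ → false) v))

  does-rev : ∀ d₀ d → does (rev d₀ ≟ᵈ d) ≡ does (d₀ ≟ᵈ rev d)
  does-rev d₀ d = does-⇔ (mk⇔
    (λ eq → trans (sym (rev-involutive d₀)) (cong rev eq))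
    (λ eq → trans (cong rev eq) (rev-involutive d))) (rev d₀ ≟ᵈ d) (d₀ ≟ᵈ rev d)

  -- The two darts of an edge differ even for a loop. A dart sum weighted by `δ` thus becomes two
  -- applications of `⨁-pick`.
  δ-darts : ∀ d₀ d → δ d₀ (proj₁ d) ≡ does (d₀ ≟ᵈ d) xor does (rev d₀ ≟ᵈ d)
  δ-darts (e₀ , b₀) (e , b) with e₀ Fin.≟ e
  ... | no _     = refl
  ... | yes refl with b₀ | b
  ... | false | false = refl
  ... | false | true  = refl
  ... | true  | false = refl
  ... | true  | true  = refl

  ∂-δ : ∀ d v → ∂ (δ d) v ≡ ⟨ tail d ⟩ v xor ⟨ head d ⟩ v
  ∂-δ d₀ v = begin
    (⨁ λ d → ⟨ tail d ⟩ v ∧ δ d₀ (proj₁ d))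
      ≡⟨ ⨁-cong (λ d → trans (cong (⟨ tail d ⟩ v ∧_) (δ-darts d₀ d))
           (trans (Bool.∧-comm (⟨ tail d ⟩ v) _)
             (Bool.∧-distribʳ-xor (⟨ tail d ⟩ v) (does (d₀ ≟ᵈ d)) _))) ⟩
    (⨁ λ d → (does (d₀ ≟ᵈ d) ∧ ⟨ tail d ⟩ v) xor (does (rev d₀ ≟ᵈ d) ∧ ⟨ tail d ⟩ v))
      ≡⟨ ⨁-xor _ _ ⟩
    (⨁ λ d → does (d₀ ≟ᵈ d) ∧ ⟨ tail d ⟩ v) xor (⨁ λ d → does (rev d₀ ≟ᵈ d) ∧ ⟨ tail d ⟩ v)
      ≡⟨ cong₂ _xor_ (⨁-pick _≟ᵈ_ (λ d → ⟨ tail d ⟩ v) d₀)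
                     (⨁-pick _≟ᵈ_ (λ d → ⟨ tail d ⟩ v) (rev d₀)) ⟩
    ⟨ tail d₀ ⟩ v xor ⟨ head d₀ ⟩ v ∎
    where open ≡-Reasoning

  ∂-combination : ∀ {n} (t : Fin n → Bool) (d : Fin n → Dart) v →
    ∂ (λ e → sum λ i → t i ∧ δ (d i) e) v ≡
    sum λ i → t i ∧ (⟨ tail (d i) ⟩ v xor ⟨ head (d i) ⟩ v)
  ∂-combination t d v = begin
    (⨁ λ d′ → ⟨ tail d′ ⟩ v ∧ sum λ i → t i ∧ δ (d i) (proj₁ d′))
      ≡⟨ ⨁-cong (λ d′ → *-distribˡ-sum (⟨ tail d′ ⟩ v) (λ i → t i ∧ δ (d i) (proj₁ d′))) ⟩
    (⨁ λ d′ → sum λ i → ⟨ tail d′ ⟩ v ∧ (t i ∧ δ (d i) (proj₁ d′)))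
      ≡⟨ ⨁-sum-comm (λ d′ i → ⟨ tail d′ ⟩ v ∧ (t i ∧ δ (d i) (proj₁ d′))) ⟩
    (sum λ i → ⨁ λ d′ → ⟨ tail d′ ⟩ v ∧ (t i ∧ δ (d i) (proj₁ d′)))
      ≡⟨ sum-cong-≗ (λ i → ⨁-cong λ d′ → ∧-swap (⟨ tail d′ ⟩ v) (t i) _) ⟩
    (sum λ i → ⨁ λ d′ → t i ∧ (⟨ tail d′ ⟩ v ∧ δ (d i) (proj₁ d′)))
      ≡⟨ sum-cong-≗ (λ i → sym (⨁-∧ (t i) _)) ⟩
    (sum λ i → t i ∧ ∂ (δ (d i)) v)
      ≡⟨ sum-cong-≗ (λ i → cong (t i ∧_) (∂-δ (d i) v)) ⟩
    (sum λ i → t i ∧ (⟨ tail (d i) ⟩ v xor ⟨ head (d i) ⟩ v)) ∎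
    where
    open ≡-Reasoning
    ∧-swap : ∀ a b c → a ∧ (b ∧ c) ≡ b ∧ (a ∧ c)
    ∧-swap false false c = refl
    ∧-swap false true  c = refl
    ∧-swap true  false c = refl
    ∧-swap true  true  c = refl

  -- A breadth-first spanning tree

  module BFS (conn : Connected) (d₀ : Dart) where
    root : Vertex
    root = tail d₀

    depth : Vertex → ℕ
    depth v = dist G conn v root

    firstDart : ∀ {u v ℓ} → Walk u v ℓ → Dart
    firstDart []            = d₀
    firstDart ((d , _) ∷ _) = d

    -- Points to the BFS parent, except at the root, where the value is irrelevant.
    up : Vertex → Dart
    up v = firstDart (proj₁ (proj₂ (shortest G conn v root)))

    up-spec : ∀ v → v ≢ root → tail (up v) ≡ v × depth (head (up v)) < depth v
    up-spec v v≢root with shortest G conn v root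
    ... | _ , [] , _ = contradiction refl v≢root
    ... | _ , ((d , td , refl) ∷ w) , _ =
      -- The rest of the shortest walk from `v` already reaches the root from the head, so it bounds
      -- the depth there.
      td , s≤s (proj₂ (proj₂ (shortest G conn (head d) root)) w)

    treeChain : (Vertex → Bool) → Chain
    treeChain t e = sum λ v → t v ∧ δ (up v) e

    -- Induction from the deepest vertices upwards: once t vanishes on the children of v,
    -- only the edge up v can contribute to the boundary at v.
    tree-acyclic : ∀ t → t root ≡ false → (∀ v → ∂ (treeChain t) v ≡ false) → ∀ v → t v ≡ false
    tree-acyclic t t-root cycle v =
      descend (proj₁ bound) v (ℕ.m≤n+m _ (depth v))
      where
      open ≡-Reasoning
      bound = ∃-upper-bound depth
      t-nonroot : ∀ w → t w ≡ true → w ≢ root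
      t-nonroot w tw refl with () ← trans (sym tw) t-root
      -- `m` bounds the number of depth levels beyond that of `v`; at `m = 0` no vertex is deeper
      -- than `v`.
      descend : ∀ m v → proj₁ bound ≤ depth v + m → t v ≡ false
      children : ∀ m v → proj₁ bound ≤ depth v + m → ∀ w → depth v < depth w → t w ≡ false
      children zero v b≤ w v<w = contradiction
        (ℕ.≤-trans v<w (ℕ.≤-trans (proj₂ bound w) (subst (proj₁ bound ≤_) (ℕ.+-identityʳ _) b≤)))
        (ℕ.<-irrefl refl)
      children (suc m) v b≤ w v<w = descend m w (ℕ.≤-trans b≤
        (subst (_≤ depth w + m) (sym (ℕ.+-suc (depth v) m)) (ℕ.+-monoˡ-≤ m v<w)))
      descend m v b≤ = begin
        t v                                                              ≡⟨ only-v (t v) refl ⟨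
        t v ∧ (⟨ tail (up v) ⟩ v xor ⟨ head (up v) ⟩ v)                  ≡⟨ sum-single v others ⟨
        (sum λ w → t w ∧ (⟨ tail (up w) ⟩ v xor ⟨ head (up w) ⟩ v))      ≡⟨ ∂-combination t up v ⟨
        ∂ (treeChain t) v                                                ≡⟨ cycle v ⟩
        false                                                            ∎
        where
        only-v : ∀ b → t v ≡ b → b ∧ (⟨ tail (up v) ⟩ v xor ⟨ head (up v) ⟩ v) ≡ b
        only-v false _ = refl
        only-v true tv with eq , lt ← up-spec v (t-nonroot v tv) = cong₂ _xor_
          (dec-true (tail (up v) Fin.≟ v) eq)
          (dec-false (head (up v) Fin.≟ v) λ h → ℕ.<-irrefl (cong depth h) lt)
        other : ∀ w b → t w ≡ b → w ≢ v → b ∧ (⟨ tail (up w) ⟩ v xor ⟨ head (up w) ⟩ v) ≡ false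
        other w false _  _   = refl
        other w true  tw w≢v with eq , lt ← up-spec w (t-nonroot w tw) = cong₂ _xor_
          (dec-false (tail (up w) Fin.≟ v) λ h → w≢v (trans (sym eq) h))
          (dec-false (head (up w) Fin.≟ v) λ h → contradiction
            (trans (sym tw) (children m v b≤ w (subst (λ x → depth x < depth w) h lt))) λ ())
        others : ∀ w → w ≢ v → t w ∧ (⟨ tail (up w) ⟩ v xor ⟨ head (up w) ⟩ v) ≡ false
        others w = other w (t w) refl

-- Cycles are boundaries

module Embedded {G : Graph} (conn : Graph.Connected G) (E : PlanarEmbedding G)
                (d₀ : Graph.Dart G) where
  open Graph G
  open PlanarEmbedding E
  open GraphTheory G
  open FiniteSum darts
  open BFS conn d₀

  face-next : ∀ d → face (next d) ≡ face d
  face-next d = sym (Equivalence.from (face-orbits d (next d)) (1 , refl))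

  tail-rot : ∀ d → tail (rot d) ≡ tail d
  tail-rot d = sym (Equivalence.from (rot-orbits d (rot d)) (1 , refl))

  rot≡next-rev : ∀ d → rot d ≡ next (rev d)
  rot≡next-rev d = cong rot (sym (rev-involutive d))

  face-rot : ∀ d → face (rot d) ≡ face (rev d)
  face-rot d = trans (cong face (rot≡next-rev d)) (face-next (rev d))

  next-injective : ∀ {d d′} → next d ≡ next d′ → d ≡ d′
  next-injective {d} {d′} eq = begin
    d            ≡⟨ rev-involutive d ⟨
    rev (rev d)  ≡⟨ cong rev rev-eq ⟩
    rev (rev d′) ≡⟨ rev-involutive d′ ⟩
    d′           ∎
    where
    open ≡-Reasoning
    rev-eq : rev d ≡ rev d′
    rev-eq = trans (sym (Inverse.strictlyInverseʳ rotation (rev d)))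
      (trans (cong (Inverse.from rotation) eq) (Inverse.strictlyInverseʳ rotation (rev d′)))

  -- The darts at a vertex form one rotation orbit, and reversing a dart passes to the next vertex
  -- of the walk. The hypotheses are local to `P` so that the colouring may change elsewhere.
  constant-along : ∀ {P} (c : Dart → Bool) →
    (∀ d → P (tail d) → c (rot d) ≡ c d) → (∀ d → P (tail d) → c (rev d) ≡ c d) →
    ∀ {u v} → WalkIn P u v → ∀ {d d′} → tail d ≡ u → tail d′ ≡ v → c d ≡ c d′
  constant-along {P} c c-rot c-rev = along
    where
    orbit : ∀ i d → P (tail d) → c (iterate rot d i) ≡ c d
    orbit zero    d p = refl
    orbit (suc i) d p = trans (orbit i (rot d) (subst P (sym (tail-rot d)) p)) (c-rot d p)
    around : ∀ {d d′} → P (tail d) → tail d ≡ tail d′ → c d ≡ c d′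
    around {d} {d′} p eq with i , refl ← Equivalence.to (rot-orbits d d′) eq = sym (orbit i d p)
    along : ∀ {u v} → WalkIn P u v → ∀ {d d′} → tail d ≡ u → tail d′ ≡ v → c d ≡ c d′
    along [ p ] refl td′ = around p (sym td′)
    along (p ∷⟨ (d₁ , td₁ , hd₁) ⟩ π) refl td′ =
      trans (around p (sym td₁))
        (trans (sym (c-rev d₁ (subst P (sym td₁) p))) (along π hd₁ td′))

  -- The boundary map from sets of faces to chains: an edge counts when exactly one of its sides is
  -- in `x`, and an edge with the same face on both sides cancels.
  bd : (Fin #F → Bool) → Chain
  bd x e = x (face (e , false)) xor x (face (e , true))

  bd-dart : ∀ x d → bd x (proj₁ d) ≡ x (face d) xor x (face (rev d))
  bd-dart x (e , false) = refl
  bd-dart x (e , true)  = Bool.xor-comm (x (face (e , false))) _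

  -- Each corner at `v` is counted twice, from the two darts that enclose it: the face of `rev d` is
  -- the face of `rot d`, and the rotation permutes the darts.
  ∂-bd : ∀ x v → ∂ (bd x) v ≡ false
  ∂-bd x v = begin
    (⨁ λ d → ⟨ tail d ⟩ v ∧ bd x (proj₁ d))
      ≡⟨ ⨁-cong (λ d → trans (cong (⟨ tail d ⟩ v ∧_) (bd-dart x d))
           (Bool.∧-distribˡ-xor (⟨ tail d ⟩ v) _ _)) ⟩
    (⨁ λ d → corner d xor (⟨ tail d ⟩ v ∧ x (face (rev d))))
      ≡⟨ ⨁-cong (λ d → cong (corner d xor_) (sym (cong₂ _∧_
           (cong (λ u → ⟨ u ⟩ v) (tail-rot d)) (cong x (face-rot d))))) ⟩
    (⨁ λ d → corner d xor corner (rot d))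
      ≡⟨ ⨁-xor _ _ ⟩
    (⨁ corner) xor (⨁ λ d → corner (rot d))
      ≡⟨ cong (⨁ corner xor_) (⨁-permute rotation corner) ⟩
    (⨁ corner) xor (⨁ corner)
      ≡⟨ Bool.xor-same (⨁ corner) ⟩
    false ∎
    where
    open ≡-Reasoning
    corner : Dart → Bool
    corner d = ⟨ tail d ⟩ v ∧ x (face d)

  -- With empty boundary `x` agrees on the two sides of every edge, and connectedness carries its
  -- value to all faces.
  bd-kernel : ∀ x → (∀ e → bd x e ≡ false) → ∀ d d′ → x (face d) ≡ x (face d′)
  bd-kernel x bd≗0 d d′ = constant-along (x ∘ face)
    (λ d _ → trans (cong x (face-rot d)) (sym (flip d)))
    (λ d _ → sym (flip d))
    (Walk⇒WalkIn (proj₂ (conn (tail d) (tail d′)))) refl refl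
    where
    flip : ∀ d → x (face d) ≡ x (face (rev d))
    flip d = xor-false⇒≡ _ _ (trans (sym (bd-dart x d)) (bd≗0 (proj₁ d)))

  -- Face boundaries and the tree edges together span all chains: Euler's formula makes
  -- the map Φ below square once the two normalising coordinates are added.
  Φ : (Fin #F ⊎ Fin #V → Bool) → Fin #E ⊎ Fin 2 → Bool
  Φ y (inj₁ e)          = bd (y ∘ inj₁) e xor treeChain (y ∘ inj₂) e
  -- These coordinates remove the remaining freedom: complementing the set of faces leaves `bd`
  -- unchanged, and the coefficient of the root belongs to no tree edge.
  Φ y (inj₂ zero)       = y (inj₁ (face d₀))
  Φ y (inj₂ (suc zero)) = y (inj₂ root)

  treeChain-false : ∀ t → (∀ v → t v ≡ false) → ∀ e → treeChain t e ≡ false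
  treeChain-false t t≗0 e = sum-false λ v → cong (_∧ δ (up v) e) (t≗0 v)

  treeChain-xor : ∀ t t′ e →
    treeChain (λ v → t v xor t′ v) e ≡ treeChain t e xor treeChain t′ e
  treeChain-xor t t′ e = trans
    (sum-cong-≗ λ v → Bool.∧-distribʳ-xor (δ (up v) e) (t v) (t′ v))
    (∑-distrib-+ (λ v → t v ∧ δ (up v) e) (λ v → t′ v ∧ δ (up v) e))

  Φ-additive : ∀ y y′ b → Φ (λ a → y a xor y′ a) b ≡ Φ y b xor Φ y′ b
  Φ-additive y y′ (inj₁ e) = trans
    (cong₂ _xor_ (xor-interchange (y (inj₁ (face (e , false)))) _ _ _)
                 (treeChain-xor (y ∘ inj₂) (y′ ∘ inj₂) e))
    (xor-interchange (bd (y ∘ inj₁) e) _ _ _)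
  Φ-additive y y′ (inj₂ zero)       = refl
  Φ-additive y y′ (inj₂ (suc zero)) = refl

  -- Face boundaries are cycles, so if the total is a cycle then so is its tree part, which must
  -- vanish. This serves both the kernel of `Φ` and the preimages of cycles.
  Φ-tree-part : ∀ y → Φ y (inj₂ (suc zero)) ≡ false → (∀ v → ∂ (Φ y ∘ inj₁) v ≡ false) →
                ∀ v → y (inj₂ v) ≡ false
  Φ-tree-part y y-root cycle = tree-acyclic (y ∘ inj₂) y-root λ v → begin
    ∂ (treeChain (y ∘ inj₂)) v
      ≡⟨ cong (_xor ∂ (treeChain (y ∘ inj₂)) v) (∂-bd (y ∘ inj₁) v) ⟨
    ∂ (bd (y ∘ inj₁)) v xor ∂ (treeChain (y ∘ inj₂)) v
      ≡⟨ ∂-xor (bd (y ∘ inj₁)) (treeChain (y ∘ inj₂)) v ⟨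
    ∂ (Φ y ∘ inj₁) v
      ≡⟨ cycle v ⟩
    false ∎
    where open ≡-Reasoning

  Φ-without-tree : ∀ y → (∀ v → y (inj₂ v) ≡ false) → ∀ e → Φ y (inj₁ e) ≡ bd (y ∘ inj₁) e
  Φ-without-tree y t≗0 e = trans
    (cong (bd (y ∘ inj₁) e xor_) (treeChain-false (y ∘ inj₂) t≗0 e)) (Bool.xor-identityʳ _)

  Φ-kernel : ∀ y → (∀ b → Φ y b ≡ false) → ∀ a → y a ≡ false
  Φ-kernel y Φy≗0 = λ
    { (inj₁ g) → let d , fd≡g = face-surj g in
        trans (cong (y ∘ inj₁) (sym fd≡g)) (trans (bd-kernel (y ∘ inj₁) bd≗0 d d₀) (Φy≗0 (inj₂ zero)))
    ; (inj₂ v) → t≗0 v }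
    where
    t≗0 : ∀ v → y (inj₂ v) ≡ false
    t≗0 = Φ-tree-part y (Φy≗0 (inj₂ (suc zero))) λ v →
      trans (∂-cong (Φy≗0 ∘ inj₁) v) (∂-false v)
    bd≗0 : ∀ e → bd (y ∘ inj₁) e ≡ false
    bd≗0 e = trans (sym (Φ-without-tree y t≗0 e)) (Φy≗0 (inj₁ e))

  -- The first homology of the sphere modulo 2 vanishes: a preimage of the cycle `z` under `Φ` has
  -- no tree part, so only a face boundary remains.
  cycle⇒boundary : ∀ z → (∀ v → ∂ z v ≡ false) → ∃[ x ] bd x ≗ z
  cycle⇒boundary z cycle = y ∘ inj₁ , λ e → trans (sym (Φ-without-tree y t≗0 e)) (Φy≗ (inj₁ e))
    where
    target : Fin #E ⊎ Fin 2 → Bool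
    target (inj₁ e) = z e
    target (inj₂ _) = false
    -- Euler's formula equates the dimensions of the source and the target of `Φ`.
    square : #E + 2 ≡ #F + #V
    square = trans (sym euler) (ℕ.+-comm #V #F)
    preimage = trivial-kernel⇒surjective Fin.+↔⊎
      (subst (λ n → Fin n ↔ (Fin #E ⊎ Fin 2)) square Fin.+↔⊎) Φ Φ-additive Φ-kernel target
    y = proj₁ preimage
    Φy≗ = proj₂ preimage
    t≗0 : ∀ v → y (inj₂ v) ≡ false
    t≗0 = Φ-tree-part y (Φy≗ (inj₂ (suc zero))) λ v →
      trans (∂-cong (Φy≗ ∘ inj₁) v) (cycle v)

-- Crossing walks

module Jordan {G : Graph} (conn : Graph.Connected G) {E : PlanarEmbedding G}
              {f : Fin (PlanarEmbedding.#F E)} {k : ℕ} (S : FacialWalk E f k) where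
  open Graph G
  open PlanarEmbedding E
  open FacialWalk S
  open GraphTheory G
  open Embedded conn E start

  pos : ℕ → Dart
  pos = iterate next start

  pos-suc : ∀ i → pos (suc i) ≡ next (pos i)
  pos-suc = iterate-suc next start

  face-pos : ∀ i → face (pos i) ≡ face start
  face-pos zero    = refl
  face-pos (suc i) = trans (cong face (pos-suc i)) (trans (face-next (pos i)) (face-pos i))

  iterate-injective : ∀ i {d d′} → iterate next d i ≡ iterate next d′ i → d ≡ d′
  iterate-injective zero    eq = eq
  iterate-injective (suc i) eq = next-injective (iterate-injective i eq)

  -- Cancelling `i` applications of the injective `next` would bring the walk back to `start` too
  -- early. Darts therefore do not repeat, although the vertices `s i` may.
  pos-<-distinct : ∀ {i j} → i < j → j < k → pos i ≢ pos j
  pos-<-distinct {i} {j} i<j j<k eq =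
    minimal (j ∸ i) (ℕ.m<n⇒0<n∸m i<j) (ℕ.≤-<-trans (ℕ.m∸n≤m j i) j<k)
      (sym (iterate-injective i (begin
        pos i                             ≡⟨ eq ⟩
        pos j                             ≡⟨ cong pos (ℕ.m∸n+n≡m (ℕ.<⇒≤ i<j)) ⟨
        pos (j ∸ i + i)                   ≡⟨ iterate-+ next start (j ∸ i) i ⟩
        iterate next (pos (j ∸ i)) i      ∎)))
    where open ≡-Reasoning

  pos-distinct : ∀ {i j} → i < k → j < k → i ≢ j → pos i ≢ pos j
  pos-distinct {i} {j} i<k j<k i≢j with ℕ.<-cmp i j
  ... | tri< i<j _ _ = pos-<-distinct i<j j<k
  ... | tri≈ _ i≡j _ = contradiction i≡j i≢j
  ... | tri> _ _ j<i = pos-<-distinct j<i i<k ∘ sym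

  -- The positions `j`, ..., `j + n - 1`, summed modulo 2. Darts are recorded rather than edges
  -- because both sides of an edge may lie on `f`.
  arc : ℕ → ℕ → Dart → Bool
  arc j zero    d = false
  arc j (suc n) d = does (pos j ≟ᵈ d) xor arc (suc j) n d

  arc-outside : ∀ j n {i} → i < j ⊎ j + n ≤ i → i < k → j + n ≤ k → arc j n (pos i) ≡ false
  arc-outside j zero    out i<k j+n≤k = refl
  arc-outside j (suc n) {i} out i<k j+n≤k = cong₂ _xor_
    (dec-false (pos j ≟ᵈ pos i) (pos-distinct j<k i<k j≢i))
    (arc-outside (suc j) n out′ i<k (subst (_≤ k) (ℕ.+-suc j n) j+n≤k))
    where
    j<j+1+n : j < j + suc n
    j<j+1+n = ℕ.m<m+n j (s≤s z≤n)
    j<k = ℕ.<-≤-trans j<j+1+n j+n≤k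
    j≢i : j ≢ i
    j≢i refl = [ ℕ.<-irrefl refl , (λ le → ℕ.<-irrefl refl (ℕ.<-≤-trans j<j+1+n le)) ]′ out
    out′ : i < suc j ⊎ suc j + n ≤ i
    out′ = [ (λ lt → inj₁ (ℕ.m<n⇒m<1+n lt)) , (λ le → inj₂ (subst (_≤ i) (ℕ.+-suc j n) le)) ]′ out

  arc-inside : ∀ j n {i} → j ≤ i → i < j + n → j + n ≤ k → arc j n (pos i) ≡ true
  arc-inside j zero    {i} j≤i i<j+n j+n≤k =
    contradiction (ℕ.<-≤-trans i<j+n (subst (_≤ i) (sym (ℕ.+-identityʳ j)) j≤i)) (ℕ.<-irrefl refl)
  arc-inside j (suc n) {i} j≤i i<j+n j+n≤k with ℕ.m≤n⇒m<n∨m≡n j≤i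
  ... | inj₂ refl = cong₂ _xor_ (dec-true (pos j ≟ᵈ pos j) refl)
        (arc-outside (suc j) n (inj₁ ℕ.≤-refl) (ℕ.<-≤-trans i<j+n j+n≤k)
          (subst (_≤ k) (ℕ.+-suc j n) j+n≤k))
  ... | inj₁ j<i  = cong₂ _xor_
        (dec-false (pos j ≟ᵈ pos i) (pos-<-distinct j<i (ℕ.<-≤-trans i<j+n j+n≤k)))
        (arc-inside (suc j) n j<i (subst (i <_) (ℕ.+-suc j n) i<j+n)
          (subst (_≤ k) (ℕ.+-suc j n) j+n≤k))

  -- The sum telescopes: following `next`, the arc is entered at `pos j` and left at `pos (j + n)`.
  arc-next : ∀ j n d →
    arc j n (next d) xor arc j n d ≡ does (pos j ≟ᵈ next d) xor does (pos (j + n) ≟ᵈ next d)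
  arc-next j zero    d rewrite ℕ.+-identityʳ j = sym (Bool.xor-same (does (pos j ≟ᵈ next d)))
  arc-next j (suc n) d = begin
    (first xor arc (suc j) n (next d)) xor (does (pos j ≟ᵈ d) xor arc (suc j) n d)
      ≡⟨ xor-interchange first _ _ _ ⟩
    (first xor does (pos j ≟ᵈ d)) xor (arc (suc j) n (next d) xor arc (suc j) n d)
      ≡⟨ cong₂ (λ a b → (first xor a) xor b) shift (arc-next (suc j) n d) ⟩
    (first xor second) xor (second xor does (pos (suc j + n) ≟ᵈ next d))
      ≡⟨ xor-cancel first second _ ⟩
    first xor does (pos (suc j + n) ≟ᵈ next d)
      ≡⟨ cong (λ m → first xor does (pos m ≟ᵈ next d)) (ℕ.+-suc j n) ⟨
    first xor does (pos (j + suc n) ≟ᵈ next d) ∎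
    where
    open ≡-Reasoning
    first second : Bool
    first  = does (pos j ≟ᵈ next d)
    second = does (pos (suc j) ≟ᵈ next d)
    shift : does (pos j ≟ᵈ d) ≡ second
    shift = does-⇔ (mk⇔
      (λ eq → trans (pos-suc j) (cong next eq))
      (λ eq → next-injective (trans (sym (pos-suc j)) eq)))
      (pos j ≟ᵈ d) (pos (suc j) ≟ᵈ next d)

  arcChain : ℕ → ℕ → Chain
  arcChain j n e = arc j n (e , false) xor arc j n (e , true)

  arcChain-dart : ∀ j n d → arcChain j n (proj₁ d) ≡ arc j n d xor arc j n (rev d)
  arcChain-dart j n (e , false) = refl
  arcChain-dart j n (e , true)  = Bool.xor-comm (arc j n (e , false)) _

  ∂-arcChain : ∀ j n v → ∂ (arcChain j n) v ≡ ⟨ s j ⟩ v xor ⟨ s (j + n) ⟩ v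
  ∂-arcChain j zero    v rewrite ℕ.+-identityʳ j =
    trans (∂-false v) (sym (Bool.xor-same (⟨ s j ⟩ v)))
  ∂-arcChain j (suc n) v = begin
    ∂ (arcChain j (suc n)) v
      ≡⟨ ∂-cong split v ⟩
    ∂ (λ e → δ (pos j) e xor arcChain (suc j) n e) v
      ≡⟨ ∂-xor (δ (pos j)) (arcChain (suc j) n) v ⟩
    ∂ (δ (pos j)) v xor ∂ (arcChain (suc j) n) v
      ≡⟨ cong₂ _xor_ (∂-δ (pos j) v) (∂-arcChain (suc j) n v) ⟩
    (⟨ s j ⟩ v xor ⟨ head (pos j) ⟩ v) xor (⟨ s (suc j) ⟩ v xor ⟨ s (suc j + n) ⟩ v)
      ≡⟨ cong (λ u → (⟨ s j ⟩ v xor ⟨ u ⟩ v) xor (⟨ s (suc j) ⟩ v xor ⟨ s (suc j + n) ⟩ v)) head-pos ⟩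
    (⟨ s j ⟩ v xor ⟨ s (suc j) ⟩ v) xor (⟨ s (suc j) ⟩ v xor ⟨ s (suc j + n) ⟩ v)
      ≡⟨ xor-cancel (⟨ s j ⟩ v) (⟨ s (suc j) ⟩ v) _ ⟩
    ⟨ s j ⟩ v xor ⟨ s (suc j + n) ⟩ v
      ≡⟨ cong (λ m → ⟨ s j ⟩ v xor ⟨ s m ⟩ v) (ℕ.+-suc j n) ⟨
    ⟨ s j ⟩ v xor ⟨ s (j + suc n) ⟩ v ∎
    where
    open ≡-Reasoning
    head-pos : head (pos j) ≡ s (suc j)
    head-pos = sym (trans (cong tail (pos-suc j)) (tail-rot (rev (pos j))))
    split : ∀ e → arcChain j (suc n) e ≡ δ (pos j) e xor arcChain (suc j) n e
    split e = trans (xor-interchange (does (pos j ≟ᵈ (e , false))) _ _ _)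
      (cong (_xor arcChain (suc j) n e) (sym (trans (δ-darts (pos j) (e , false))
        (cong (does (pos j ≟ᵈ (e , false)) xor_) (does-rev (pos j) (e , false))))))

  walkChain : ∀ {P u v} → WalkIn P u v → Chain
  walkChain [ _ ]                e = false
  walkChain (_ ∷⟨ d , _ ⟩ π) e = δ d e xor walkChain π e

  ∂-walkChain : ∀ {P u w} (π : WalkIn P u w) v → ∂ (walkChain π) v ≡ ⟨ u ⟩ v xor ⟨ w ⟩ v
  ∂-walkChain {u = u} [ _ ] v = trans (∂-false v) (sym (Bool.xor-same (⟨ u ⟩ v)))
  ∂-walkChain {w = w} (_ ∷⟨ d , refl , refl ⟩ π) v = begin
    ∂ (λ e → δ d e xor walkChain π e) v
      ≡⟨ ∂-xor (δ d) (walkChain π) v ⟩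
    ∂ (δ d) v xor ∂ (walkChain π) v
      ≡⟨ cong₂ _xor_ (∂-δ d v) (∂-walkChain π v) ⟩
    (⟨ tail d ⟩ v xor ⟨ head d ⟩ v) xor (⟨ head d ⟩ v xor ⟨ w ⟩ v)
      ≡⟨ xor-cancel (⟨ tail d ⟩ v) (⟨ head d ⟩ v) _ ⟩
    ⟨ tail d ⟩ v xor ⟨ w ⟩ v ∎
    where open ≡-Reasoning

  -- Both ends of every edge of the walk satisfy `P`, so whichever dart of such an edge is taken,
  -- its tail does too.
  walkChain-avoids : ∀ {P u v} (π : WalkIn P u v) d → ¬ P (tail d) → walkChain π (proj₁ d) ≡ false
  walkChain-avoids [ _ ] d ¬p = refl
  walkChain-avoids {P} (p ∷⟨ d₁ , refl , refl ⟩ π) d ¬p = cong₂ _xor_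
    (dec-false (proj₁ d₁ Fin.≟ proj₁ d) (not-same d₁ d p (walkIn-first π) ¬p))
    (walkChain-avoids π d ¬p)
    where
    not-same : ∀ d₁ d → P (tail d₁) → P (head d₁) → ¬ P (tail d) → proj₁ d₁ ≢ proj₁ d
    not-same (e , false) (_ , false) p q ¬p refl = ¬p p
    not-same (e , false) (_ , true)  p q ¬p refl = ¬p q
    not-same (e , true)  (_ , false) p q ¬p refl = ¬p q
    not-same (e , true)  (_ , true)  p q ¬p refl = ¬p p

  -- The closed walk formed by π and the facial arc from s a to s c bounds a set x of faces.
  -- Splitting f along that arc turns x into a colouring of darts which changes only across π.
  crossing : ∀ {P Q a b c d} → a ≤ b → b < c → c ≤ d → d < k → (∀ {w} → P w → ¬ Q w) →
             WalkIn P (s a) (s c) → ¬ WalkIn Q (s b) (s d)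
  crossing {P} {Q} {a} {b} {c} {d} a≤b b<c c≤d d<k disjoint π ρ
    with n , refl ← ℕ.m≤n⇒∃[o]m+o≡n (ℕ.≤-trans a≤b (ℕ.<⇒≤ b<c)) =
      contradiction (begin
        true                ≡⟨ arc-inside a n a≤b b<c a+n≤k ⟨
        arc a n (pos b)     ≡⟨ same-arc ⟩
        arc a n (pos d)     ≡⟨ arc-outside a n (inj₂ c≤d) d<k a+n≤k ⟩
        false               ∎) λ ()
    where
    open ≡-Reasoning
    a+n≤k : a + n ≤ k
    a+n≤k = ℕ.≤-trans c≤d (ℕ.<⇒≤ d<k)

    boundary : ∃[ x ] bd x ≗ (λ e → walkChain π e xor arcChain a n e)
    boundary = cycle⇒boundary _ λ v → begin
      ∂ (λ e → walkChain π e xor arcChain a n e) v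
        ≡⟨ ∂-xor (walkChain π) (arcChain a n) v ⟩
      ∂ (walkChain π) v xor ∂ (arcChain a n) v
        ≡⟨ cong₂ _xor_ (∂-walkChain π v) (∂-arcChain a n v) ⟩
      (⟨ s a ⟩ v xor ⟨ s (a + n) ⟩ v) xor (⟨ s a ⟩ v xor ⟨ s (a + n) ⟩ v)
        ≡⟨ Bool.xor-same (⟨ s a ⟩ v xor ⟨ s (a + n) ⟩ v) ⟩
      false ∎

    x = proj₁ boundary

    colour : Dart → Bool
    colour d = x (face d) xor arc a n d

    across : ∀ d → colour d xor colour (rev d) ≡ walkChain π (proj₁ d)
    across d = begin
      (x (face d) xor arc a n d) xor (x (face (rev d)) xor arc a n (rev d))
        ≡⟨ xor-interchange (x (face d)) _ _ _ ⟩
      (x (face d) xor x (face (rev d))) xor (arc a n d xor arc a n (rev d))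
        ≡⟨ cong₂ _xor_ (sym (bd-dart x d)) (sym (arcChain-dart a n d)) ⟩
      bd x (proj₁ d) xor arcChain a n (proj₁ d)
        ≡⟨ cong (_xor arcChain a n (proj₁ d)) (proj₂ boundary (proj₁ d)) ⟩
      (walkChain π (proj₁ d) xor arcChain a n (proj₁ d)) xor arcChain a n (proj₁ d)
        ≡⟨ Bool.xor-assoc (walkChain π (proj₁ d)) _ _ ⟩
      walkChain π (proj₁ d) xor (arcChain a n (proj₁ d) xor arcChain a n (proj₁ d))
        ≡⟨ cong (walkChain π (proj₁ d) xor_) (Bool.xor-same (arcChain a n (proj₁ d))) ⟩
      walkChain π (proj₁ d) xor false
        ≡⟨ Bool.xor-identityʳ _ ⟩
      walkChain π (proj₁ d) ∎

    colour-rev : ∀ d → Q (tail d) → colour (rev d) ≡ colour d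
    colour-rev d q = sym (xor-false⇒≡ _ _ (trans (across d)
      (walkChain-avoids π d λ p → disjoint p q)))

    pos≢next : ∀ i d → P (s i) → Q (tail (next d)) → does (pos i ≟ᵈ next d) ≡ false
    pos≢next i d p q = dec-false (pos i ≟ᵈ next d) λ eq → disjoint p (subst Q (cong tail (sym eq)) q)

    -- The arc indicator jumps only at `pos a` and `pos (a + n)`. Their tails are the end points of
    -- `π`, which satisfy `P` and hence not `Q`.
    colour-next : ∀ d → Q (tail (next d)) → colour (next d) ≡ colour d
    colour-next d q = cong₂ _xor_ (cong x (face-next d)) (xor-false⇒≡ _ _ (trans (arc-next a n d)
      (cong₂ _xor_ (pos≢next a d (walkIn-first π) q)
                   (pos≢next (a + n) d (walkIn-first (walkIn-sym π)) q))))

    colour-rot : ∀ d → Q (tail d) → colour (rot d) ≡ colour d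
    colour-rot d q = begin
      colour (rot d)        ≡⟨ cong colour (rot≡next-rev d) ⟩
      colour (next (rev d)) ≡⟨ colour-next (rev d)
                                 (subst Q (trans (sym (tail-rot d)) (cong tail (rot≡next-rev d))) q) ⟩
      colour (rev d)        ≡⟨ colour-rev d q ⟩
      colour d              ∎

    -- Both darts lie on the face of `start`, so `x` contributes equally to their colours and
    -- cancels.
    same-arc : arc a n (pos b) ≡ arc a n (pos d)
    same-arc = xor-cancelˡ (x (face start)) (begin
      x (face start) xor arc a n (pos b)
        ≡⟨ cong (λ g → x g xor arc a n (pos b)) (face-pos b) ⟨
      colour (pos b)
        ≡⟨ constant-along colour colour-rot colour-rev ρ refl refl ⟩
      colour (pos d)
        ≡⟨ cong (λ g → x g xor arc a n (pos d)) (face-pos d) ⟩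
      x (face start) xor arc a n (pos d) ∎)

-- Counting patterns

module Metric {G : Graph} (conn : Graph.Connected G) where
  open Graph G
  open GraphTheory G

  d : Vertex → Vertex → ℕ
  d = dist G conn

  d-walk : ∀ u v → Walk u v (d u v)
  d-walk u v = proj₁ (proj₂ (shortest G conn u v))

  d-≤-walk : ∀ {u v ℓ} → Walk u v ℓ → d u v ≤ ℓ
  d-≤-walk = proj₂ (proj₂ (shortest G conn _ _))

  triangle : ∀ u v w → d u w ≤ d u v + d v w
  triangle u v w = d-≤-walk (walk-trans (d-walk u v) (d-walk v w))

  d-adjacent : ∀ v {x y} → Adjacent x y → d v y ≤ suc (d v x)
  d-adjacent v {x} {y} a = subst (d v y ≤_) (ℕ.+-comm (d v x) 1)
    (d-≤-walk (walk-trans (d-walk v x) (a ∷ [])))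

  OnGeodesic : Vertex → Vertex → Vertex → Set
  OnGeodesic v x w = d v w + d w x ≤ d v x

  geodesic : ∀ v x → WalkIn (OnGeodesic v x) v x
  geodesic v x = along (d-walk v x) (ℕ.+-monoˡ-≤ (d v x) (d-≤-walk []))
    where
    -- Invariant: the distance already covered plus the `ℓ` edges still ahead stays within `d v x`.
    along : ∀ {u ℓ} → Walk u x ℓ → d v u + ℓ ≤ d v x → WalkIn (OnGeodesic v x) u x
    along {u} []              le = [ ℕ.≤-trans (ℕ.+-monoʳ-≤ (d v u) (d-≤-walk [])) le ]
    along {u} (_∷_ {ℓ = ℓ} a w) le = ℕ.≤-trans (ℕ.+-monoʳ-≤ (d v u) (d-≤-walk (a ∷ w))) le
      ∷⟨ a ⟩ along w (ℕ.≤-trans (ℕ.+-monoˡ-≤ ℓ (d-adjacent v a))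
                       (subst (_≤ d v x) (ℕ.+-suc (d v u) ℓ) le))

  -- Swapping tails at `w` gives walks from `v` to `y` and from `u` to `x` of the same total length
  -- as the two geodesics.
  exchange : ∀ {v u x y w} → OnGeodesic v x w → OnGeodesic u y w → d v y + d u x ≤ d v x + d u y
  exchange {v} {u} {x} {y} {w} vx uy = begin
    d v y + d u x                          ≤⟨ ℕ.+-mono-≤ (triangle v w y) (triangle u w x) ⟩
    (d v w + d w y) + (d u w + d w x)      ≡⟨ swap (d v w) (d w y) (d u w) (d w x) ⟩
    (d v w + d w x) + (d u w + d w y)      ≤⟨ ℕ.+-mono-≤ vx uy ⟩
    d v x + d u y                          ∎
    where
    open ℕ.≤-Reasoning
    swap : ∀ a b c e → (a + b) + (c + e) ≡ (a + e) + (c + b)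
    swap = solve-∀

module Counting {G : Graph} (conn : Graph.Connected G) {E : PlanarEmbedding G}
                {f : Fin (PlanarEmbedding.#F E)} {k : ℕ} (S : FacialWalk E f k) where
  open Graph G
  open FacialWalk S
  open GraphTheory G
  open Metric conn
  open Embedded conn E start using (tail-rot)
  open Jordan conn S using (pos; pos-suc; crossing)

  -- d v x − d u x < d v y − d u y, without truncated subtraction.
  _⊢_≺_ : Vertex × Vertex → Vertex → Vertex → Set
  (v , u) ⊢ x ≺ y = d v x + d u y < d v y + d u x

  -- Geodesics from `v` join `s a` to `s c`, and geodesics from `u` join `s b` to `s e`. At a common
  -- vertex `exchange` would contradict one of the four inequalities, so the two walks are disjoint,
  -- which `crossing` forbids.
  no-alternation : ∀ {v u a b c e} → a ≤ b → b < c → c ≤ e → e < k →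
    (v , u) ⊢ s a ≺ s b → (v , u) ⊢ s a ≺ s e → (v , u) ⊢ s c ≺ s b → ¬ ((v , u) ⊢ s c ≺ s e)
  no-alternation {v} {u} {a} {b} {c} {e} a≤b b<c c≤e e<k ab ae cb ce =
    crossing {λ w → OnGeodesic v (s a) w ⊎ OnGeodesic v (s c) w}
             {λ w → OnGeodesic u (s b) w ⊎ OnGeodesic u (s e) w}
      a≤b b<c c≤e e<k
      (λ { (inj₁ p) (inj₁ q) → ℕ.<⇒≱ ab (exchange p q)
         ; (inj₁ p) (inj₂ q) → ℕ.<⇒≱ ae (exchange p q)
         ; (inj₂ p) (inj₁ q) → ℕ.<⇒≱ cb (exchange p q)
         ; (inj₂ p) (inj₂ q) → ℕ.<⇒≱ ce (exchange p q) })
      (both v (s a) (s c)) (both u (s b) (s e))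
    where
    both : ∀ v x y → WalkIn (λ w → OnGeodesic v x w ⊎ OnGeodesic v y w) x y
    both v x y = walkIn-trans (walkIn-sym (walkIn-map inj₁ (geodesic v x))) (walkIn-map inj₂ (geodesic v y))

  s-adjacent : ∀ i → Adjacent (s i) (s (suc i))
  s-adjacent i = pos i , refl , sym (trans (cong tail (pos-suc i)) (tail-rot (rev (pos i))))

  d-s-≤ : ∀ v i → d v (s i) ≤ d v (s 0) + i
  d-s-≤ v zero    = ℕ.m≤m+n _ 0
  d-s-≤ v (suc i) = ℕ.≤-trans (d-adjacent v (s-adjacent i))
    (subst (suc (d v (s i)) ≤_) (sym (ℕ.+-suc _ i)) (s≤s (d-s-≤ v i)))

  d-s₀-≤ : ∀ v i → d v (s 0) ≤ d v (s i) + i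
  d-s₀-≤ v zero    = ℕ.m≤m+n _ 0
  d-s₀-≤ v (suc i) = ℕ.≤-trans (d-s₀-≤ v i)
    (subst (d v (s i) + i ≤_) (sym (ℕ.+-suc _ i))
      (ℕ.+-monoˡ-≤ i (d-adjacent v (Adjacent-sym (s-adjacent i)))))

  -- d v (s i) − d v (s 0), shifted by k so that the subtraction does not truncate.
  height : Vertex → ℕ → ℕ
  height v i = d v (s i) + k ∸ d v (s 0)

  height-+ : ∀ v {i} → i ≤ k → height v i + d v (s 0) ≡ d v (s i) + k
  height-+ v {i} i≤k = ℕ.m∸n+n≡m (ℕ.≤-trans (d-s₀-≤ v i) (ℕ.+-monoʳ-≤ (d v (s i)) i≤k))

  height-≤ : ∀ v {i} → i ≤ k → height v i ≤ k + k
  height-≤ v {i} i≤k = ℕ.+-cancelʳ-≤ (d v (s 0)) _ _ (begin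
    height v i + d v (s 0)   ≡⟨ height-+ v i≤k ⟩
    d v (s i) + k            ≤⟨ ℕ.+-monoˡ-≤ k (d-s-≤ v i) ⟩
    d v (s 0) + i + k        ≤⟨ ℕ.+-monoˡ-≤ k (ℕ.+-monoʳ-≤ (d v (s 0)) i≤k) ⟩
    d v (s 0) + k + k        ≡⟨ trans (ℕ.+-assoc (d v (s 0)) k k) (ℕ.+-comm (d v (s 0)) _) ⟩
    (k + k) + d v (s 0)      ∎)
    where open ℕ.≤-Reasoning

  height-zero : ∀ v → height v 0 ≡ k
  height-zero v = ℕ.m+n∸m≡n (d v (s 0)) k

  height-adjacent : ∀ v {i j} → i ≤ k → j ≤ k → Adjacent (s i) (s j) → height v j ≤ suc (height v i)
  height-adjacent v {i} {j} i≤k j≤k a = ℕ.+-cancelʳ-≤ (d v (s 0)) _ _ (begin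
    height v j + d v (s 0)         ≡⟨ height-+ v j≤k ⟩
    d v (s j) + k                  ≤⟨ ℕ.+-monoˡ-≤ k (d-adjacent v a) ⟩
    suc (d v (s i) + k)            ≡⟨ cong suc (height-+ v i≤k) ⟨
    suc (height v i) + d v (s 0)   ∎)
    where open ℕ.≤-Reasoning

  height-pair : ∀ v u {i j} → i ≤ k → j ≤ k →
    (height v i + height u j) + (d v (s 0) + d u (s 0)) ≡ (d v (s i) + d u (s j)) + (k + k)
  height-pair v u {i} {j} i≤k j≤k = begin
    (height v i + height u j) + (d v (s 0) + d u (s 0)) ≡⟨ swap (height v i) _ _ _ ⟩
    (height v i + d v (s 0)) + (height u j + d u (s 0)) ≡⟨ cong₂ _+_ (height-+ v i≤k) (height-+ u j≤k) ⟩
    (d v (s i) + k) + (d u (s j) + k)                   ≡⟨ swap (d v (s i)) k _ k ⟩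
    (d v (s i) + d u (s j)) + (k + k)                   ∎
    where
    open ≡-Reasoning
    swap : ∀ a b c e → (a + b) + (c + e) ≡ (a + c) + (b + e)
    swap = solve-∀

  -- Equal heights at `i` serve as the reference level: in the sum over both vertices the distances
  -- to `s 0` cancel.
  height-≺ : ∀ v u {i j} → i ≤ k → j ≤ k → height v i ≡ height u i → height u j < height v j →
             (v , u) ⊢ s i ≺ s j
  height-≺ v u {i} {j} i≤k j≤k eq lt = ℕ.+-cancelʳ-< (k + k) _ _ (begin-strict
    (d v (s i) + d u (s j)) + (k + k)                   ≡⟨ height-pair v u i≤k j≤k ⟨
    (height v i + height u j) + (d v (s 0) + d u (s 0))
      ≡⟨ cong (λ h → h + height u j + (d v (s 0) + d u (s 0))) eq ⟩
    (height u i + height u j) + (d v (s 0) + d u (s 0))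
      <⟨ ℕ.+-monoˡ-< _ (ℕ.+-monoʳ-< (height u i) lt) ⟩
    (height u i + height v j) + (d v (s 0) + d u (s 0))
      ≡⟨ cong (_+ (d v (s 0) + d u (s 0))) (ℕ.+-comm (height u i) _) ⟩
    (height v j + height u i) + (d v (s 0) + d u (s 0)) ≡⟨ height-pair v u j≤k i≤k ⟩
    (d v (s j) + d u (s i)) + (k + k)                   ∎)
    where open ℕ.≤-Reasoning

  -- Classes of vertices with equal height profiles

  SameUpTo : ℕ → Vertex → Vertex → Set
  SameUpTo j v u = ∀ i → i ≤ j → height v i ≡ height u i

  -- Otherwise d v ∙ − d u′ ∙ would alternate at the positions 0, i, j, j + 1.
  branching-≮ : ∀ {j v v′ u′ i} → suc j < k → SameUpTo j u′ v′ → i ≤ j →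
    height v j ≡ height v′ j → height v (suc j) ≡ height v′ (suc j) →
    height u′ (suc j) < height v′ (suc j) → ¬ (height v′ i < height v i)
  branching-≮ {j} {v} {v′} {u′} {i} j+1<k u′~v′ i≤j at-j at-j+1 below lt with ℕ.m≤n⇒m<n∨m≡n i≤j
  ... | inj₂ refl = ℕ.<-irrefl (sym at-j) lt
  ... | inj₁ i<j  = no-alternation {v} {u′} z≤n i<j (ℕ.n≤1+n j) j+1<k
        (height-≺ v u′ z≤n i≤k at-0 above-i) (height-≺ v u′ z≤n (ℕ.<⇒≤ j+1<k) at-0 above-j+1)
        (height-≺ v u′ j≤k i≤k at-j′ above-i) (height-≺ v u′ j≤k (ℕ.<⇒≤ j+1<k) at-j′ above-j+1)
    where
    j≤k = ℕ.≤-trans (ℕ.n≤1+n j) (ℕ.<⇒≤ j+1<k)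
    i≤k = ℕ.≤-trans i≤j j≤k
    at-0 = trans (height-zero v) (sym (height-zero u′))
    at-j′ = trans at-j (sym (u′~v′ j ℕ.≤-refl))
    above-i = subst (_< height v i) (sym (u′~v′ i i≤j)) lt
    above-j+1 = subst (height u′ (suc j) <_) (sym at-j+1) below

  -- `u` and `u′` witness that neither `v` nor `v′` takes the lowest step in its class. Applying
  -- `branching-≮` in both directions then excludes a difference at any earlier position.
  branching-unique : ∀ {j v v′ u u′} → suc j < k → SameUpTo j u v → SameUpTo j u′ v′ →
    height u (suc j) < height v (suc j) → height u′ (suc j) < height v′ (suc j) →
    height v j ≡ height v′ j → height v (suc j) ≡ height v′ (suc j) → SameUpTo (suc j) v v′
  branching-unique {j} {v} {v′} j+1<k u~v u′~v′ below below′ at-j at-j+1 i i≤j+1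
    with ℕ.m≤n⇒m<n∨m≡n i≤j+1
  ... | inj₂ refl      = at-j+1
  ... | inj₁ (s≤s i≤j) = ℕ.≤-antisym
        (ℕ.≮⇒≥ (branching-≮ {v = v} j+1<k u′~v′ i≤j at-j at-j+1 below′))
        (ℕ.≮⇒≥ (branching-≮ {v = v′} j+1<k u~v i≤j (sym at-j) (sym at-j+1) below))

  -- Each position adds at most `2k + 1` heights times the three steps -1, 0 and 1.
  #classes : ℕ → ℕ
  #classes zero    = 1
  #classes (suc j) = #classes j + suc (k + k) * 3

  record Labelling (j : ℕ) : Set where
    field
      label : Vertex → Fin (#classes j)
      sound : ∀ u v → label u ≡ label v → SameUpTo j u v

  -- A vertex keeps its label if its step from j to j + 1 is minimal in its class; the
  -- others are determined by their height at j and that step.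
  labelling : ∀ j → j < k → Labelling j
  labelling zero _ = record
    { label = λ _ → zero
    ; sound = λ { u v _ _ z≤n → trans (height-zero u) (sym (height-zero v)) } }
  labelling (suc j) j+1<k = record
    { label = λ v → join (#classes j) _ (new v (branching? v))
    ; sound = λ u v eq → new-sound u v (branching? u) (branching? v) (join-injective eq) }
    where
    open Labelling (labelling j (ℕ.<-trans (ℕ.n<1+n j) j+1<k))
    j+1≤k = ℕ.<⇒≤ j+1<k
    j≤k = ℕ.≤-trans (ℕ.n≤1+n j) j+1≤k

    Branching : Vertex → Set
    Branching v = ∃[ u ] (label u ≡ label v × height u (suc j) < height v (suc j))

    branching? : Decidable Branching
    branching? v = Fin.any? λ u →
      (label u Fin.≟ label v) ×-dec (height u (suc j) ℕ.<? height v (suc j))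

    heightᶠ : Vertex → Fin (suc (k + k))
    heightᶠ v = fromℕ< (s≤s (height-≤ v j≤k))

    -- The step is shifted up by one, to 0, 1 or 2, so that the subtraction does not truncate.
    step≤2 : ∀ v → suc (height v (suc j)) ∸ height v j ≤ 2
    step≤2 v = ℕ.m≤n+o⇒m∸n≤o _ (height v j) (subst (suc (height v (suc j)) ≤_) (ℕ.+-comm 2 (height v j))
      (s≤s (height-adjacent v j≤k j+1≤k (s-adjacent j))))

    stepᶠ : Vertex → Fin 3
    stepᶠ v = fromℕ< (s≤s (step≤2 v))

    stepᶠ-injective : ∀ u v → height u j ≡ height v j → stepᶠ u ≡ stepᶠ v →
                      height u (suc j) ≡ height v (suc j)
    stepᶠ-injective u v at-j eq = ℕ.suc-injective (begin
      suc (height u (suc j))                            ≡⟨ ℕ.m∸n+n≡m (back u) ⟨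
      suc (height u (suc j)) ∸ height u j + height u j  ≡⟨ cong₂ _+_ (Fin.fromℕ<-injective _ _ _ _ eq) at-j ⟩
      suc (height v (suc j)) ∸ height v j + height v j  ≡⟨ ℕ.m∸n+n≡m (back v) ⟩
      suc (height v (suc j))                            ∎)
      where
      open ≡-Reasoning
      back : ∀ v → height v j ≤ suc (height v (suc j))
      back v = height-adjacent v j+1≤k j≤k (Adjacent-sym (s-adjacent j))

    new : ∀ v → Dec (Branching v) → Fin (#classes j) ⊎ Fin (suc (k + k) * 3)
    new v (no  _) = inj₁ (label v)
    new v (yes _) = inj₂ (combine (heightᶠ v) (stepᶠ v))

    new-sound : ∀ u v b? b?′ → new u b? ≡ new v b?′ → SameUpTo (suc j) u v
    new-sound u v (no ¬b) (no ¬b′) eq i i≤j+1 with ℕ.m≤n⇒m<n∨m≡n i≤j+1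
    ... | inj₁ (s≤s i≤j) = sound u v (inj₁-injective eq) i i≤j
    -- Both vertices attain the minimal next height of the same class.
    ... | inj₂ refl      = ℕ.≤-antisym
          (ℕ.≮⇒≥ λ lt → ¬b (v , sym (inj₁-injective eq) , lt))
          (ℕ.≮⇒≥ λ lt → ¬b′ (u , inj₁-injective eq , lt))
    new-sound u v (yes (u₀ , lu , below)) (yes (v₀ , lv , below′)) eq
      with eqʰ , eqˢ ← Fin.combine-injective (heightᶠ u) (stepᶠ u) (heightᶠ v) (stepᶠ v)
                         (inj₂-injective eq) =
      branching-unique j+1<k (sound u₀ u lu) (sound v₀ v lv) below below′ at-j
        (stepᶠ-injective u v at-j eqˢ)
      where at-j = Fin.fromℕ<-injective _ _ _ _ eqʰ

  -- A pattern entry is a difference of consecutive heights. It is compared after cross-adding,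
  -- where the distances to `s 0` cancel.
  SameUpTo⇒pattern : ∀ {u v} → SameUpTo (pred k) u v → pattern-of conn S u ≡ pattern-of conn S v
  SameUpTo⇒pattern {u} {v} u~v = Vec.tabulate-cong λ i → +-minus-cong
    (d u (s (suc (toℕ i)))) (d u (s (toℕ i))) (d v (s (suc (toℕ i)))) (d v (s (toℕ i)))
    (ℕ.+-cancelʳ-≡ (k + k) _ _ (begin
    (d u (s (suc (toℕ i))) + d v (s (toℕ i))) + (k + k)
      ≡⟨ height-pair u v (i+1≤k i) (i≤k i) ⟨
    (height u (suc (toℕ i)) + height v (toℕ i)) + (d u (s 0) + d v (s 0))
      ≡⟨ cong₂ _+_ (cong₂ _+_ (u~v _ (Fin.toℕ<n i)) (sym (u~v _ (ℕ.<⇒≤ (Fin.toℕ<n i)))))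
                   (ℕ.+-comm (d u (s 0)) _) ⟩
    (height v (suc (toℕ i)) + height u (toℕ i)) + (d v (s 0) + d u (s 0))
      ≡⟨ height-pair v u (i+1≤k i) (i≤k i) ⟩
    (d v (s (suc (toℕ i))) + d u (s (toℕ i))) + (k + k) ∎))
    where
    open ≡-Reasoning
    i+1≤k : ∀ (i : Fin (pred k)) → suc (toℕ i) ≤ k
    i+1≤k i = ℕ.≤-trans (Fin.toℕ<n i) ℕ.pred[n]≤n
    i≤k : ∀ (i : Fin (pred k)) → toℕ i ≤ k
    i≤k i = ℕ.<⇒≤ (i+1≤k i)

  #patterns-≤ : 1 ≤ k → #patterns conn S ≤ #classes (pred k)
  #patterns-≤ 1≤k = length-deduplicate-≤ _ (pattern-of conn S) label
    λ {u} {v} eq → SameUpTo⇒pattern (sound u v eq)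
    where open Labelling (labelling (pred k) (ℕ.≤-reflexive (ℕ.suc-pred k {{>-nonZero 1≤k}})))

  #classes-closed : ∀ j → #classes j ≡ 1 + j * (suc (k + k) * 3)
  #classes-closed zero    = refl
  #classes-closed (suc j) rewrite #classes-closed j =
    cong suc (ℕ.+-comm (j * (suc (k + k) * 3)) (suc (k + k) * 3))

theorem1 : ∃[ C ] (∀ (G : Graph) (conn : Graph.Connected G) (E : PlanarEmbedding G)
    (f : Fin (PlanarEmbedding.#F E)) (k : ℕ) → 1 ≤ k →
    (S : FacialWalk E f k) →
    #patterns conn S ≤ C * k ^ 2)
-- With `k = m + 1` the number of labels is `6m² + 9m + 1`, and `9k²` exceeds it by `3m² + 9m + 8`.
theorem1 = 9 , λ { G conn E f (suc m) 1≤k S → bound conn S 1≤k }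
  where
  arithmetic : ∀ m → 1 + m * ((1 + ((1 + m) + (1 + m))) * 3) + (3 * m * m + 9 * m + 8) ≡
                     9 * ((1 + m) * ((1 + m) * 1))
  arithmetic = solve-∀

  bound : ∀ {G} conn {E : PlanarEmbedding G} {f m} (S : FacialWalk E f (suc m)) → 1 ≤ suc m →
          #patterns conn S ≤ 9 * suc m ^ 2
  bound conn {m = m} S 1≤k = begin
    #patterns conn S
      ≤⟨ #patterns-≤ 1≤k ⟩
    #classes m
      ≡⟨ #classes-closed m ⟩
    1 + m * (suc (suc m + suc m) * 3)
      ≤⟨ ℕ.m≤m+n _ (3 * m * m + 9 * m + 8) ⟩
    1 + m * (suc (suc m + suc m) * 3) + (3 * m * m + 9 * m + 8)
      ≡⟨ arithmetic m ⟩
    9 * suc m ^ 2 ∎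
    where
    open Counting conn S
    open ℕ.≤-Reasoning
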